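{- For every $5\le n\le 13$, the following pair of sequences $A=(a_0,\ldots,a_{n-2})$, $B=(b_0,\ldots,b_{n-2})$ forms a geodesic Leech labeling of $W_n$, where $a_i$ is the label of the spoke $uv_i$ and $b_i$ is the label of the rim edge $v_iv_{i+1}$ (indices modulo $n-1$): \begin{itemize} \item $W_5$: $A=(6,2,7,3)$, $B=(1,10,4,8)$; \item $W_6$: $A=(14,7,6,5,11)$, $B=(1,3,13,2,8)$; \item $W_7$: $A=(4,5,2,14,22,7)$, $B=(15,8,17,3,10,1)$; \item $W_8$: $A=(9,6,7,21,13,8,5)$, $B=(10,24,4,31,1,2,23)$; \item $W_9$: $A=(5,8,1,13,34,28,9,3)$, $B=(12,20,24,2,25,15,23,7)$; \item $W_{10}$: $A=(15,4,19,39,29,1,7,13,2)$, $B=(8,10,35,12,25,24,27,23,30)$; \item $W_{11}$: $A=(1,32,33,16,22,9,27,4,29,31)$, $B=(2,44,21,18,6,8,3,12,7,50)$; \item $W_{12}$: $A=(10,31,17,22,26,13,38,39,2,37,3)$, $B=(1,8,66,11,7,14,58,4,67,6,45)$; \item $W_{13}$: $A=(25,10,36,16,30,44,2,42,3,43,46,21)$, $B=(4,7,15,74,1,34,50,20,9,8,6,77)$. \end{itemize} In particular, $W_n$ is geodesic Leech for every $n\in\{5,6,\ldots,13\}$.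
   Context: Graphs are finite, simple, undirected and connected. A geodesic of a graph $G$ is a shortest path between two distinct vertices; a path and its reverse are regarded as the same, but distinct shortest paths with the same endpoints are counted separately. Let $t_{gp}(G)$ be the number of geodesics of $G$. For an edge labeling $f:E(G)\to\{1,2,3,\ldots\}$, the weight of a path is the sum of the labels of its edges. The labeling $f$ is a geodesic Leech labeling if the multiset of the weights of all geodesics of $G$ is exactly $\{1,2,\ldots,t_{gp}(G)\}$, each value occurring once. A graph is geodesic Leech if it admits a geodesic Leech labeling. $W_n$ denotes the wheel on $n$ vertices: a hub $u$ joined to every vertex of a rim cycle $v_0,v_1,\ldots,v_{n-2}$ of length $n-1$ (in cyclic order). -}

module Defs where

open import Data.Bool.Base using (if_then_else_)
open import Data.Empty using (⊥)
open import Data.Fin.Base using (Fin; zero; suc; toℕ)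
open import Data.Fin.Properties using (_≟_)
open import Data.List.Base using (List; []; _∷_; applyUpTo; head; last; length; map; reverse)
open import Data.List.Properties using (reverse-involutive)
open import Data.List.Relation.Binary.Permutation.Propositional using (_↭_)
open import Data.List.Relation.Unary.Enumerates.Setoid using (IsEnumeration)
open import Data.List.Relation.Unary.Linked using (Linked)
open import Data.List.Relation.Unary.Unique.Propositional using (Unique)
import Data.List.Relation.Unary.Unique.Setoid as USetoid
open import Data.Maybe.Base using (just)
open import Data.Nat.Base using (ℕ; zero; suc; _+_; _≤_)
open import Data.Nat.DivMod using (_mod_)
open import Data.Product.Base using (∃-syntax; _×_; _,_)
open import Data.Sum.Base using (_⊎_; inj₁; inj₂; swap)
open import Data.Unit.Base using (⊤; tt)
open import Data.Vec.Base using (Vec; lookup)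
open import Level using (0ℓ)
open import Relation.Binary.Bundles using (Setoid)
open import Relation.Binary.Construct.Closure.ReflexiveTransitive using (Star; ε; _◅_)
open import Relation.Binary.Core using (Rel)
open import Relation.Binary.Definitions using (Decidable; Irreflexive; Symmetric)
open import Relation.Binary.PropositionalEquality
  using (_≡_; _≢_; refl; sym; trans; cong; ≢-sym)
open import Relation.Nullary.Decidable using (does; yes; no; ¬?; _×-dec_; _⊎-dec_)

record Graph (n : ℕ) : Set₁ where
  field
    Adj       : Rel (Fin n) 0ℓ
    adj?      : Decidable Adj
    irrefl    : Irreflexive _≡_ Adj
    symmetric : Symmetric Adj
    connected : ∀ u v → Star Adj u v

module _ {n : ℕ} (G : Graph n) where
  open Graph G

  -- Graphs are simple, so a path is determined by its sequence of vertices.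
  record IsPath (u v : Fin n) (xs : List (Fin n)) : Set where
    field
      linked   : Linked Adj xs
      distinct : Unique xs
      source   : head xs ≡ just u
      target   : last xs ≡ just v

  -- `length` counts vertices, one more than the number of edges; this does
  -- not affect which paths are shortest.
  record Geodesic : Set where
    field
      {source target} : Fin n
      vertices        : List (Fin n)
      source≢target   : source ≢ target
      isPath          : IsPath source target vertices
      shortest        : ∀ {ys} → IsPath source target ys → length vertices ≤ length ys

  open Geodesic using (vertices)

  SameUpToReversal : Rel Geodesic 0ℓ
  SameUpToReversal p q = vertices p ≡ vertices q ⊎ vertices p ≡ reverse (vertices q)

  geodesicSetoid : Setoid 0ℓ 0ℓ
  geodesicSetoid = record
    { Carrier       = Geodesic
    ; _≈_           = SameUpToReversal
    ; isEquivalence = record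
      { refl  = inj₁ refl
      ; sym   = λ where
          (inj₁ p≡q)  → inj₁ (sym p≡q)
          (inj₂ p≡q⁻) → inj₂ (flip p≡q⁻)
      ; trans = λ where
          (inj₁ p≡q)  (inj₁ q≡r)  → inj₁ (trans p≡q q≡r)
          (inj₁ p≡q)  (inj₂ q≡r⁻) → inj₂ (trans p≡q q≡r⁻)
          (inj₂ p≡q⁻) (inj₁ q≡r)  → inj₂ (trans p≡q⁻ (cong reverse q≡r))
          (inj₂ p≡q⁻) (inj₂ q≡r⁻) → inj₁ (trans p≡q⁻ (sym (flip q≡r⁻)))
      }
    }
    where
    flip : ∀ {xs ys : List (Fin n)} → xs ≡ reverse ys → ys ≡ reverse xs
    flip {ys = ys} eq = trans (sym (reverse-involutive ys)) (cong reverse (sym eq))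

  -- A list containing every geodesic exactly once up to reversal; its length
  -- is therefore the number of geodesics of G.
  record GeodesicEnumeration : Set where
    field
      geodesics : List Geodesic
      unique    : USetoid.Unique geodesicSetoid geodesics
      complete  : IsEnumeration geodesicSetoid geodesics

    t-gp : ℕ
    t-gp = length geodesics

  -- An edge labeling is given by a function on pairs of vertices whose values
  -- on non-adjacent pairs are irrelevant.
  record IsEdgeLabeling (f : Fin n → Fin n → ℕ) : Set where
    field
      label-sym : ∀ {u v} → Adj u v → f u v ≡ f v u
      label-pos : ∀ {u v} → Adj u v → 1 ≤ f u v

  weight : (Fin n → Fin n → ℕ) → List (Fin n) → ℕ
  weight f (x ∷ y ∷ xs) = f x y + weight f (y ∷ xs)
  weight f _            = 0

  -- Enumerations differ only in the order of the geodesics and in the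
  -- direction in which each is traversed, neither of which changes the
  -- multiset of weights, so it is immaterial which one is used.
  record IsGeodesicLeechLabeling (f : Fin n → Fin n → ℕ) : Set where
    field
      isEdgeLabeling : IsEdgeLabeling f
      enumeration    : GeodesicEnumeration
    open GeodesicEnumeration enumeration public
    field
      weights        : map (λ p → weight f (vertices p)) geodesics ↭ applyUpTo suc t-gp

  IsGeodesicLeech : Set
  IsGeodesicLeech = ∃[ f ] IsGeodesicLeechLabeling f

next : ∀ {k} → Fin k → Fin k
next {suc k} i = suc (toℕ i) mod suc k

-- The hub is `zero` and the rim vertex v_i is `suc i`.  The condition i ≢ j
-- is automatic once the rim has at least two vertices; it only lets the wheel
-- be defined for every n, and n ≥ 4 are the genuine wheels.
WheelAdj : ∀ {n} → Rel (Fin n) 0ℓ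
WheelAdj zero    zero    = ⊥
WheelAdj zero    (suc _) = ⊤
WheelAdj (suc _) zero    = ⊤
WheelAdj (suc i) (suc j) = i ≢ j × (j ≡ next i ⊎ i ≡ next j)

W : ∀ n → Graph n
W n = record
  { Adj       = WheelAdj
  ; adj?      = dec
  ; irrefl    = irr
  ; symmetric = λ {u} {v} → symm u v
  ; connected = conn
  }
  where
  dec : ∀ {n} → Decidable (WheelAdj {n})
  dec zero    zero    = no λ ()
  dec zero    (suc _) = yes tt
  dec (suc _) zero    = yes tt
  dec (suc i) (suc j) = ¬? (i ≟ j) ×-dec ((j ≟ next i) ⊎-dec (i ≟ next j))

  irr : ∀ {n} → Irreflexive _≡_ (WheelAdj {n})
  irr {x = zero}  refl ()
  irr {x = suc _} refl (i≢i , _) = i≢i refl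

  symm : ∀ {n} (u v : Fin n) → WheelAdj u v → WheelAdj v u
  symm zero    (suc _) _         = tt
  symm (suc _) zero    _         = tt
  symm (suc _) (suc _) (i≢j , e) = ≢-sym i≢j , swap e

  conn : ∀ {n} (u v : Fin n) → Star WheelAdj u v
  conn zero    zero    = ε
  conn zero    (suc _) = tt ◅ ε
  conn (suc _) zero    = tt ◅ ε
  conn (suc _) (suc _) = _◅_ {j = zero} tt (tt ◅ ε)

-- The labeling of W (suc k) with label a_i on the spoke u v_i and label b_i on
-- the rim edge v_i v_{i+1}.  For k ≥ 3 at most one of the two rim tests
-- succeeds.
wheelLabeling : ∀ {k} → Vec ℕ k → Vec ℕ k → Fin (suc k) → Fin (suc k) → ℕ
wheelLabeling A B zero    zero    = 0
wheelLabeling A B zero    (suc i) = lookup A i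
wheelLabeling A B (suc i) zero    = lookup A i
wheelLabeling A B (suc i) (suc j) =
  if does (j ≟ next i) then lookup B i else
  if does (i ≟ next j) then lookup B j else 0

{-# OPTIONS --safe #-}

-- Any two distinct vertices of a wheel are adjacent or joined by a path of
-- length two through the hub, so its geodesics are exactly the edges and the
-- paths u m v with u, v distinct and non-adjacent.  Orienting each of them from
-- the smaller to the larger endpoint picks one representative per class up to
-- reversal.  This gives a computable list of geodesics, and the Leech property
-- of a labeling becomes the equation "the sorted weights are 1, …, t".
module Submission where

open import Data.Empty using (⊥)
open import Data.Fin.Base using (Fin; zero; suc)
import Data.Fin.Base as Fin
import Data.Fin.Properties as Fin
open import Data.List.Base
  using (List; []; _∷_; _++_; allFin; applyUpTo; cartesianProductWith; filter; length; map; reverse)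
open import Data.List.Membership.Propositional using (_∈_)
open import Data.List.Membership.Propositional.Properties
  using (∈-++⁺ˡ; ∈-++⁺ʳ; ∈-allFin; ∈-cartesianProductWith⁺; ∈-cartesianProductWith⁻; ∈-filter⁺)
open import Data.List.Properties using (∷-injective; length-map; map-∘; reverse-involutive)
open import Data.List.Relation.Binary.Permutation.Propositional using (_↭_; ↭-reflexive; ↭-sym; ↭-trans)
open import Data.List.Relation.Unary.All as All using (All; []; _∷_)
import Data.List.Relation.Unary.All.Properties as All
open import Data.List.Relation.Unary.AllPairs using (AllPairs; []; _∷_)
import Data.List.Relation.Unary.AllPairs.Properties as AllPairs
open import Data.List.Relation.Unary.Any as Any using (Any)
import Data.List.Relation.Unary.Any.Properties as Any
open import Data.List.Relation.Unary.Linked using ([-]; _∷_)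
open import Data.List.Relation.Unary.Unique.Propositional using (Unique)
import Data.List.Relation.Unary.Unique.Propositional.Properties as Unique
open import Data.List.Sort.Base using (SortingAlgorithm)
open import Data.List.Sort.InsertionSort using (insertionSort)
open import Data.Maybe.Properties using (just-injective)
open import Data.Nat.Base using (ℕ; zero; suc; _+_; _≤_; z≤n; s≤s)
open import Data.Nat.Properties using
  (_≟_; _≤?_; ≤-antisym; ≤-decTotalOrder; ≤∧≢⇒<; m≤n⇒∃[o]m+o≡n; +-cancelˡ-≤)
open import Data.Product.Base using (∃-syntax; _×_; _,_; proj₁; proj₂)
open import Data.Sum.Base using (_⊎_; inj₁; inj₂)
open import Data.Unit.Base using (tt)
open import Data.Vec.Base using (Vec; []; _∷_)
open import Function.Base using (_∘_)
open import Relation.Binary.Definitions using (tri<; tri≈; tri>)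
open import Relation.Binary.PropositionalEquality
  using (_≡_; _≢_; refl; sym; trans; cong; cong₂; subst; subst₂)
open import Relation.Nullary using (¬_; Dec; yes; no; contradiction)
open import Relation.Nullary.Decidable using (True; toWitness; ¬?; _×-dec_; _→-dec_)
open import Defs

-- `Data.List.Sort.sort` is abstract and would not reduce.
open SortingAlgorithm (insertionSort ≤-decTotalOrder) using (sort; sort-↭)

-- Vertex sequences of a fixed length.

words : ∀ n → ℕ → List (List (Fin n))
words n zero    = [] ∷ []
words n (suc k) = cartesianProductWith _∷_ (allFin n) (words n k)

words-unique : ∀ n k → Unique (words n k)
words-unique n zero    = [] ∷ []
words-unique n (suc k) =
  Unique.cartesianProductWith⁺ _∷_ ∷-injective (Unique.allFin⁺ n) (words-unique n k)

∈-words⁺ : ∀ {n} (xs : List (Fin n)) → xs ∈ words n (length xs)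
∈-words⁺ []       = Any.here refl
∈-words⁺ (x ∷ xs) = ∈-cartesianProductWith⁺ _∷_ (∈-allFin x) (∈-words⁺ xs)

∈-words⁻ : ∀ {n} k {xs} → xs ∈ words n k → length xs ≡ k
∈-words⁻     zero    (Any.here refl) = refl
∈-words⁻ {n} (suc k) xs∈
  with _ , _ , _ , ys∈ , refl ← ∈-cartesianProductWith⁻ _∷_ (allFin n) (words n k) xs∈
  = cong suc (∈-words⁻ k ys∈)

-- Geodesics of graphs of diameter at most two.

module DiameterTwo {n : ℕ} (G : Graph n)
  (common-neighbour : ∀ {u v} → u ≢ v → ¬ Graph.Adj G u v →
                      ∃[ m ] Graph.Adj G u m × Graph.Adj G m v) where

  open Graph G
  open Geodesic using (vertices)

  -- In the three-vertex clause, `¬ Adj u v` is what makes the path shortest. That `m` differs from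
  -- both ends comes from irreflexivity of `Adj`.
  Canonical : List (Fin n) → Set
  Canonical (u ∷ v ∷ [])     = u Fin.< v × Adj u v
  Canonical (u ∷ m ∷ v ∷ []) = u Fin.< v × ¬ Adj u v × Adj u m × Adj m v
  Canonical _                = ⊥

  canonical? : ∀ xs → Dec (Canonical xs)
  canonical? []                  = no λ ()
  canonical? (_ ∷ [])            = no λ ()
  canonical? (u ∷ v ∷ [])        = u Fin.<? v ×-dec adj? u v
  canonical? (u ∷ m ∷ v ∷ [])    = u Fin.<? v ×-dec ¬? (adj? u v) ×-dec adj? u m ×-dec adj? m v
  canonical? (_ ∷ _ ∷ _ ∷ _ ∷ _) = no λ ()

  -- The lengths count vertices: 2 for an edge, 3 for a path of two edges. Filtering a finite
  -- superset by a decidable predicate keeps `paths` computable.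
  candidates : List (List (Fin n))
  candidates = words n 2 ++ words n 3

  paths : List (List (Fin n))
  paths = filter canonical? candidates

  paths-unique : Unique paths
  paths-unique = Unique.filter⁺ canonical?
    -- The two halves are disjoint because their words have different lengths.
    (Unique.++⁺ (words-unique n 2) (words-unique n 3) λ (xs∈₂ , xs∈₃) →
      contradiction (trans (sym (∈-words⁻ 2 xs∈₂)) (∈-words⁻ 3 xs∈₃)) λ ())

  canonical⇒∈candidates : ∀ xs → Canonical xs → xs ∈ candidates
  canonical⇒∈candidates xs@(_ ∷ _ ∷ [])     _ = ∈-++⁺ˡ (∈-words⁺ xs)
  canonical⇒∈candidates xs@(_ ∷ _ ∷ _ ∷ []) _ = ∈-++⁺ʳ (words n 2) (∈-words⁺ xs)

  canonical⇒∈paths : ∀ {xs} → Canonical xs → xs ∈ paths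
  canonical⇒∈paths {xs} c = ∈-filter⁺ canonical? (canonical⇒∈candidates xs c) c

  -- Reversal swaps the endpoints, so both `u < v` and `v < u` would hold. Splitting on `ys` lets
  -- `reverse ys` compute, after which `refl` determines `xs`.
  canonical-≢-reverse : ∀ xs ys → Canonical xs → Canonical ys → xs ≢ reverse ys
  canonical-≢-reverse _ (_ ∷ _ ∷ [])     (v<u , _) (u<v , _) refl = Fin.<-asym u<v v<u
  canonical-≢-reverse _ (_ ∷ _ ∷ _ ∷ []) (v<u , _) (u<v , _) refl = Fin.<-asym u<v v<u

  -- Path lengths and the passage from canonical paths to geodesics.

  2≤length : ∀ {u v xs} → u ≢ v → IsPath G u v xs → 2 ≤ length xs
  2≤length {xs = []}        u≢v p with () ← IsPath.source p
  2≤length {xs = _ ∷ []}    u≢v p =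
    contradiction (just-injective (trans (sym (IsPath.source p)) (IsPath.target p))) u≢v
  2≤length {xs = _ ∷ _ ∷ _} u≢v p = s≤s (s≤s z≤n)

  path-length-2 : ∀ {u v xs} → IsPath G u v xs → length xs ≡ 2 → xs ≡ u ∷ v ∷ [] × Adj u v
  path-length-2 {xs = _ ∷ _ ∷ []}
    record { linked = uv ∷ _ ; source = refl ; target = refl } refl = refl , uv

  path-length-3 : ∀ {u v xs} → IsPath G u v xs → length xs ≡ 3 →
                  ∃[ m ] xs ≡ u ∷ m ∷ v ∷ [] × Adj u m × Adj m v
  path-length-3 {xs = _ ∷ _ ∷ _ ∷ []}
    record { linked = um ∷ mv ∷ _ ; source = refl ; target = refl } refl = _ , refl , um , mv

  -- A path on two vertices would be an edge between its ends.
  3≤length : ∀ {u v xs} → u ≢ v → ¬ Adj u v → IsPath G u v xs → 3 ≤ length xs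
  3≤length u≢v ¬uv p =
    ≤∧≢⇒< (2≤length u≢v p) λ 2≡length → ¬uv (proj₂ (path-length-2 p (sym 2≡length)))

  Adj⇒≢ : ∀ {u v} → Adj u v → u ≢ v
  Adj⇒≢ uv u≡v = irrefl u≡v uv

  edge-isPath : ∀ {u v} → Adj u v → IsPath G u v (u ∷ v ∷ [])
  edge-isPath uv = record
    { linked   = uv ∷ [-]
    ; distinct = (Adj⇒≢ uv ∷ []) ∷ [] ∷ []
    ; source   = refl
    ; target   = refl
    }

  cherry-isPath : ∀ {u m v} → u ≢ v → Adj u m → Adj m v → IsPath G u v (u ∷ m ∷ v ∷ [])
  cherry-isPath u≢v um mv = record
    { linked   = um ∷ mv ∷ [-]
    ; distinct = (Adj⇒≢ um ∷ u≢v ∷ []) ∷ (Adj⇒≢ mv ∷ []) ∷ [] ∷ []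
    ; source   = refl
    ; target   = refl
    }

  toGeodesic : ∀ {xs} → Canonical xs → Geodesic G
  toGeodesic {xs@(_ ∷ _ ∷ [])} (u<v , uv) = record
    { vertices      = xs
    ; source≢target = Fin.<⇒≢ u<v
    ; isPath        = edge-isPath uv
    ; shortest      = 2≤length (Fin.<⇒≢ u<v)
    }
  toGeodesic {xs@(_ ∷ _ ∷ _ ∷ [])} (u<v , ¬uv , um , mv) = record
    { vertices      = xs
    ; source≢target = Fin.<⇒≢ u<v
    ; isPath        = cherry-isPath (Fin.<⇒≢ u<v) um mv
    ; shortest      = 3≤length (Fin.<⇒≢ u<v) ¬uv
    }

  vertices-toGeodesic : ∀ {xs} (c : Canonical xs) → vertices (toGeodesic c) ≡ xs
  vertices-toGeodesic {_ ∷ _ ∷ []}     _ = refl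
  vertices-toGeodesic {_ ∷ _ ∷ _ ∷ []} _ = refl

  map-vertices-reduce : ∀ {xss} (cs : All Canonical xss) →
                        map vertices (All.reduce toGeodesic cs) ≡ xss
  map-vertices-reduce []       = refl
  map-vertices-reduce (c ∷ cs) = cong₂ _∷_ (vertices-toGeodesic c) (map-vertices-reduce cs)

  geodesics : List (Geodesic G)
  geodesics = All.reduce toGeodesic (All.all-filter canonical? candidates)

  -- The bridge between geodesics, which carry proofs, and bare vertex lists. Uniqueness,
  -- completeness and weights are all settled for `paths` and transported along this equation.
  map-vertices-geodesics : map vertices geodesics ≡ paths
  map-vertices-geodesics = map-vertices-reduce (All.all-filter canonical? candidates)

  -- An explicit edge or two-edge path bounds the length of a geodesic from above, and the lower
  -- bounds meet it. The length is therefore exactly 2 or 3, which fixes the shape; comparing the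
  -- endpoints then decides the direction.
  canonical-⊎-reverse : (p : Geodesic G) →
                        Canonical (vertices p) ⊎ Canonical (reverse (vertices p))
  canonical-⊎-reverse record { source≢target = u≢v ; isPath = isPath ; shortest = shortest }
    with adj? _ _
  ... | yes uv
    with refl , _ ← path-length-2 isPath (≤-antisym (shortest (edge-isPath uv)) (2≤length u≢v isPath))
    with Fin.<-cmp _ _
  ...   | tri< u<v _ _ = inj₁ (u<v , uv)
  ...   | tri≈ _ u≡v _ = contradiction u≡v u≢v
  ...   | tri> _ _ v<u = inj₂ (v<u , symmetric uv)
  canonical-⊎-reverse record { source≢target = u≢v ; isPath = isPath ; shortest = shortest }
    | no ¬uv
    -- This common neighbour serves only to bound the length by 3. The middle vertex of the geodesic
    -- itself may be another one and is read off by `path-length-3`.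
    with _ , um′ , m′v ← common-neighbour u≢v ¬uv
    with _ , refl , um , mv ← path-length-3 isPath
           (≤-antisym (shortest (cherry-isPath u≢v um′ m′v)) (3≤length u≢v ¬uv isPath))
    with Fin.<-cmp _ _
  ...   | tri< u<v _ _ = inj₁ (u<v , ¬uv , um , mv)
  ...   | tri≈ _ u≡v _ = contradiction u≡v u≢v
  ...   | tri> _ _ v<u = inj₂ (v<u , ¬uv ∘ symmetric , symmetric mv , symmetric um)

  Distinct : List (Fin n) → List (Fin n) → Set
  Distinct xs ys = ¬ (xs ≡ ys ⊎ xs ≡ reverse ys)

  -- Identifying a path with its reverse causes no new coincidences, by `canonical-≢-reverse`.
  -- `Distinct` is the negation of `SameUpToReversal` read on vertex lists, so that `AllPairs.map⁻`
  -- turns the result into uniqueness in `geodesicSetoid`.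
  canonical-distinct : ∀ {xss} → All Canonical xss → Unique xss → AllPairs Distinct xss
  canonical-distinct []       []         = []
  canonical-distinct (c ∷ cs) (xs≢ ∷ ps) =
    All.zipWith (λ where
      (_  , xs≢ys) (inj₁ xs≡ys)  → xs≢ys xs≡ys
      (c′ , _)     (inj₂ xs≡ys⁻) → canonical-≢-reverse _ _ c c′ xs≡ys⁻) (cs , xs≢)
    ∷ canonical-distinct cs ps

  paths-distinct : AllPairs Distinct paths
  paths-distinct = canonical-distinct (All.all-filter canonical? candidates) paths-unique

  flip-reverse : {xs ys : List (Fin n)} → reverse xs ≡ ys → xs ≡ reverse ys
  flip-reverse {xs} eq = trans (sym (reverse-involutive xs)) (cong reverse eq)

  geodesicEnumeration : GeodesicEnumeration G
  geodesicEnumeration = record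
    { geodesics = geodesics
    ; unique    = AllPairs.map⁻ (subst (AllPairs Distinct) (sym map-vertices-geodesics) paths-distinct)
    ; complete  = complete
    }
    where
    ∈paths⇒Any : ∀ {xs} → xs ∈ paths → Any (λ q → xs ≡ vertices q) geodesics
    ∈paths⇒Any xs∈ = Any.map⁻ (subst (_ ∈_) (sym map-vertices-geodesics) xs∈)

    complete : ∀ p → Any (SameUpToReversal G p) geodesics
    complete p with canonical-⊎-reverse p
    ... | inj₁ c = Any.map inj₁ (∈paths⇒Any (canonical⇒∈paths c))
    ... | inj₂ c = Any.map (inj₂ ∘ flip-reverse) (∈paths⇒Any (canonical⇒∈paths c))

  -- The Leech property as a finite computation.

  module _ (f : Fin n → Fin n → ℕ) where

    edgeLabel? : ∀ u v → Dec (Adj u v → f u v ≡ f v u × 1 ≤ f u v)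
    edgeLabel? u v = adj? u v →-dec (f u v ≟ f v u ×-dec 1 ≤? f u v)

    edgeLabeling? : Dec (∀ u v → Adj u v → f u v ≡ f v u × 1 ≤ f u v)
    edgeLabeling? = Fin.all? λ u → Fin.all? λ v → edgeLabel? u v

    -- Sorting only permutes the weights, so an equation between the sorted list and 1, ..., t
    -- already gives the required permutation.
    isGeodesicLeechLabeling :
      {_ : True edgeLabeling?} →
      sort (map (weight G f) paths) ≡ applyUpTo suc (length paths) →
      IsGeodesicLeechLabeling G f
    isGeodesicLeechLabeling {ok} sorted = record
      { isEdgeLabeling = record
        { label-sym = λ {u} {v} uv → proj₁ (toWitness ok u v uv)
        ; label-pos = λ {u} {v} uv → proj₂ (toWitness ok u v uv)
        }
      ; enumeration = geodesicEnumeration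
      -- The first equation turns the weights of `paths` into those of `geodesics`, the second turns
      -- `length paths` into `t-gp`.
      ; weights     = subst₂ (λ ws t → ws ↭ applyUpTo suc t)
          (trans (cong (map (weight G f)) (sym map-vertices-geodesics)) (sym (map-∘ geodesics)))
          (trans (cong length (sym map-vertices-geodesics)) (length-map vertices geodesics))
          (↭-trans (↭-sym (sort-↭ _)) (↭-reflexive sorted))
      }

-- Wheels and their explicit labelings.

hub-common-neighbour : ∀ {n} {u v : Fin n} → u ≢ v → ¬ WheelAdj u v →
                       ∃[ m ] WheelAdj u m × WheelAdj m v
hub-common-neighbour {u = zero}  {zero}  u≢v _   = contradiction refl u≢v
hub-common-neighbour {u = zero}  {suc _} _   ¬uv = contradiction tt ¬uv
hub-common-neighbour {u = suc _} {zero}  _   ¬uv = contradiction tt ¬uv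
hub-common-neighbour {u = suc _} {suc _} _   _   = zero , tt , tt

module Wheel n = DiameterTwo (W n) hub-common-neighbour

-- For closed vectors `A` and `B` everything evaluates: the implicit argument has type `⊤` once the
-- decision returns `yes` and is then filled automatically, and the equation becomes one between
-- closed lists.
wheel-leech : ∀ {k} (A B : Vec ℕ k) (let open Wheel (suc k); f = wheelLabeling A B) →
              {_ : True (edgeLabeling? f)} →
              sort (map (weight (W (suc k)) f) paths) ≡ applyUpTo suc (length paths) →
              IsGeodesicLeechLabeling (W (suc k)) f
wheel-leech A B {ok} = Wheel.isGeodesicLeechLabeling _ (wheelLabeling A B) {ok}

theorem9p1 : ( IsGeodesicLeechLabeling (W 5)
    (wheelLabeling (6 ∷ 2 ∷ 7 ∷ 3 ∷ [])
    (1 ∷ 10 ∷ 4 ∷ 8 ∷ []))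
    × IsGeodesicLeechLabeling (W 6)
    (wheelLabeling (14 ∷ 7 ∷ 6 ∷ 5 ∷ 11 ∷ [])
    (1 ∷ 3 ∷ 13 ∷ 2 ∷ 8 ∷ []))
    × IsGeodesicLeechLabeling (W 7)
    (wheelLabeling (4 ∷ 5 ∷ 2 ∷ 14 ∷ 22 ∷ 7 ∷ [])
    (15 ∷ 8 ∷ 17 ∷ 3 ∷ 10 ∷ 1 ∷ []))
    × IsGeodesicLeechLabeling (W 8)
    (wheelLabeling (9 ∷ 6 ∷ 7 ∷ 21 ∷ 13 ∷ 8 ∷ 5 ∷ [])
    (10 ∷ 24 ∷ 4 ∷ 31 ∷ 1 ∷ 2 ∷ 23 ∷ []))
    × IsGeodesicLeechLabeling (W 9)
    (wheelLabeling (5 ∷ 8 ∷ 1 ∷ 13 ∷ 34 ∷ 28 ∷ 9 ∷ 3 ∷ [])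
    (12 ∷ 20 ∷ 24 ∷ 2 ∷ 25 ∷ 15 ∷ 23 ∷ 7 ∷ []))
    × IsGeodesicLeechLabeling (W 10)
    (wheelLabeling (15 ∷ 4 ∷ 19 ∷ 39 ∷ 29 ∷ 1 ∷ 7 ∷ 13 ∷ 2 ∷ [])
    (8 ∷ 10 ∷ 35 ∷ 12 ∷ 25 ∷ 24 ∷ 27 ∷ 23 ∷ 30 ∷ []))
    × IsGeodesicLeechLabeling (W 11)
    (wheelLabeling (1 ∷ 32 ∷ 33 ∷ 16 ∷ 22 ∷ 9 ∷ 27 ∷ 4 ∷ 29 ∷ 31 ∷ [])
    (2 ∷ 44 ∷ 21 ∷ 18 ∷ 6 ∷ 8 ∷ 3 ∷ 12 ∷ 7 ∷ 50 ∷ []))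
    × IsGeodesicLeechLabeling (W 12)
    (wheelLabeling (10 ∷ 31 ∷ 17 ∷ 22 ∷ 26 ∷ 13 ∷ 38 ∷ 39 ∷ 2 ∷ 37 ∷ 3 ∷ [])
    (1 ∷ 8 ∷ 66 ∷ 11 ∷ 7 ∷ 14 ∷ 58 ∷ 4 ∷ 67 ∷ 6 ∷ 45 ∷ []))
    × IsGeodesicLeechLabeling (W 13)
    (wheelLabeling (25 ∷ 10 ∷ 36 ∷ 16 ∷ 30 ∷ 44 ∷ 2 ∷ 42 ∷ 3 ∷ 43 ∷ 46 ∷ 21 ∷ [])
    (4 ∷ 7 ∷ 15 ∷ 74 ∷ 1 ∷ 34 ∷ 50 ∷ 20 ∷ 9 ∷ 8 ∷ 6 ∷ 77 ∷ [])) )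
    × (∀ (n : ℕ) → 5 ≤ n → n ≤ 13 → IsGeodesicLeech (W n))
theorem9p1 = (w5 , w6 , w7 , w8 , w9 , w10 , w11 , w12 , w13) , isLeech
  where
  -- With k rim vertices, k ≥ 4, there are 2k edges, k(k-1)/2 - k paths through the hub between
  -- non-adjacent rim vertices, and k two-edge paths along the rim. Hence each `refl` compares lists
  -- of length k(k+3)/2, from 14 for `w5` to 90 for `w13`.
  w5 = wheel-leech (6 ∷ 2 ∷ 7 ∷ 3 ∷ [])
                   (1 ∷ 10 ∷ 4 ∷ 8 ∷ []) refl
  w6 = wheel-leech (14 ∷ 7 ∷ 6 ∷ 5 ∷ 11 ∷ [])
                   (1 ∷ 3 ∷ 13 ∷ 2 ∷ 8 ∷ []) refl
  w7 = wheel-leech (4 ∷ 5 ∷ 2 ∷ 14 ∷ 22 ∷ 7 ∷ [])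
                   (15 ∷ 8 ∷ 17 ∷ 3 ∷ 10 ∷ 1 ∷ []) refl
  w8 = wheel-leech (9 ∷ 6 ∷ 7 ∷ 21 ∷ 13 ∷ 8 ∷ 5 ∷ [])
                   (10 ∷ 24 ∷ 4 ∷ 31 ∷ 1 ∷ 2 ∷ 23 ∷ []) refl
  w9 = wheel-leech (5 ∷ 8 ∷ 1 ∷ 13 ∷ 34 ∷ 28 ∷ 9 ∷ 3 ∷ [])
                   (12 ∷ 20 ∷ 24 ∷ 2 ∷ 25 ∷ 15 ∷ 23 ∷ 7 ∷ []) refl
  w10 = wheel-leech (15 ∷ 4 ∷ 19 ∷ 39 ∷ 29 ∷ 1 ∷ 7 ∷ 13 ∷ 2 ∷ [])
                    (8 ∷ 10 ∷ 35 ∷ 12 ∷ 25 ∷ 24 ∷ 27 ∷ 23 ∷ 30 ∷ []) refl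
  w11 = wheel-leech (1 ∷ 32 ∷ 33 ∷ 16 ∷ 22 ∷ 9 ∷ 27 ∷ 4 ∷ 29 ∷ 31 ∷ [])
                    (2 ∷ 44 ∷ 21 ∷ 18 ∷ 6 ∷ 8 ∷ 3 ∷ 12 ∷ 7 ∷ 50 ∷ []) refl
  w12 = wheel-leech (10 ∷ 31 ∷ 17 ∷ 22 ∷ 26 ∷ 13 ∷ 38 ∷ 39 ∷ 2 ∷ 37 ∷ 3 ∷ [])
                    (1 ∷ 8 ∷ 66 ∷ 11 ∷ 7 ∷ 14 ∷ 58 ∷ 4 ∷ 67 ∷ 6 ∷ 45 ∷ []) refl
  w13 = wheel-leech (25 ∷ 10 ∷ 36 ∷ 16 ∷ 30 ∷ 44 ∷ 2 ∷ 42 ∷ 3 ∷ 43 ∷ 46 ∷ 21 ∷ [])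
                    (4 ∷ 7 ∷ 15 ∷ 74 ∷ 1 ∷ 34 ∷ 50 ∷ 20 ∷ 9 ∷ 8 ∷ 6 ∷ 77 ∷ []) refl

  -- Collecting the nine cases over the list 5, ..., 13 replaces a case split on n. Each `_` is the
  -- labeling, inferred from the proof paired with it.
  allLeech : All (λ n → IsGeodesicLeech (W n)) (applyUpTo (5 +_) 9)
  allLeech = (_ , w5) ∷ (_ , w6) ∷ (_ , w7) ∷ (_ , w8) ∷ (_ , w9) ∷
             (_ , w10) ∷ (_ , w11) ∷ (_ , w12) ∷ (_ , w13) ∷ []

  isLeech : ∀ n → 5 ≤ n → n ≤ 13 → IsGeodesicLeech (W n)
  isLeech n 5≤n n≤13 with k , refl ← m≤n⇒∃[o]m+o≡n 5≤n =
    -- Here n is `5 + k`, so n ≤ 13 cancels to k ≤ 8; `s≤s` makes this the strict bound k < 9 on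
    -- positions in a list of nine entries.
    All.applyUpTo⁻ (5 +_) 9 allLeech (s≤s (+-cancelˡ-≤ 5 k 8 n≤13))
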